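{- Let $F(x)=\sum_{n>0} f(n)x^n$ be a formal power series with integer coefficients such that $f(1)=1$. Let $A(x)=\sum_{n>0}a(n)x^n$ be a formal power series with real coefficients and $a(1)=1$ satisfying the functional equation $$A(A(x))=\frac{F(4x)}{4}.$$ Then $A(x)$ has integer coefficients, i.e. $a(n)\in\mathbb{Z}$ for all $n\ge 1$.
   Context: Composition of power series is formal composition, and $\frac{F(4x)}{4}$ denotes the formal power series $\sum_{n>0}4^{n-1}f(n)x^n$. -}

module Defs where

open import Algebra.Bundles using (CommutativeRing)
import Algebra.Definitions
open import Algebra.Structures using (IsCommutativeRing)
import Algebra.Properties.Monoid.Sum as MonoidSum
open import Data.Fin.Base using (toℕ)
import Data.Integer.Base as ℤ
open import Data.Integer.Base using (ℤ)
import Data.Nat.Base as ℕ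
open import Data.Nat.Base using (ℕ; zero; suc)
import Data.Nat.Properties as ℕₚ
open import Data.Product.Base using (∃; _×_; _,_; proj₁; proj₂)
import Data.Rational.Base as ℚ
open import Data.Rational.Base using (ℚ; 0ℚ; 1ℚ; ½)
import Data.Rational.Properties as ℚₚ
open import Data.Rational.Solver using (module +-*-Solver)
open import Level using (0ℓ)
open import Relation.Binary.PropositionalEquality
  using (_≡_; refl; sym; trans; cong; cong₂; subst)

private
  Small : (ℕ → ℕ → ℚ) → Set
  Small s = ∀ ε → 0ℚ ℚ.< ε →
    ∃ λ N → ∀ m n → N ℕ.≤ m → N ℕ.≤ n → ℚ.∣ s m n ∣ ℚ.< ε

  Bounded : (ℕ → ℕ → ℚ) → Set
  Bounded s = ∃ λ B → 0ℚ ℚ.< B ×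
    ∃ λ N → ∀ m n → N ℕ.≤ m → N ℕ.≤ n → ℚ.∣ s m n ∣ ℚ.≤ B

  small-cong : ∀ {s t} → (∀ m n → s m n ≡ t m n) → Small s → Small t
  small-cong s≡t small ε ε>0 with N , p ← small ε ε>0 =
    N , λ m n N≤m N≤n → subst (λ q → ℚ.∣ q ∣ ℚ.< ε) (s≡t m n) (p m n N≤m N≤n)

  small-0 : Small (λ _ _ → 0ℚ)
  small-0 ε ε>0 = 0 , λ _ _ _ _ → ε>0

  small-neg : ∀ {s} → Small s → Small (λ m n → ℚ.- s m n)
  small-neg {s} small ε ε>0 with N , p ← small ε ε>0 =
    N , λ m n N≤m N≤n →
      subst (ℚ._< ε) (sym (ℚₚ.∣-p∣≡∣p∣ (s m n))) (p m n N≤m N≤n)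

  small-+ : ∀ {s t} → Small s → Small t → Small (λ m n → s m n ℚ.+ t m n)
  small-+ {s} {t} smallₛ smallₜ ε ε>0 = N₁ ℕ.⊔ N₂ , λ m n N≤m N≤n → begin-strict
      ℚ.∣ s m n ℚ.+ t m n ∣
        ≤⟨ ℚₚ.∣p+q∣≤∣p∣+∣q∣ (s m n) (t m n) ⟩
      ℚ.∣ s m n ∣ ℚ.+ ℚ.∣ t m n ∣
        <⟨ ℚₚ.+-mono-<
             (p₁ m n (ℕₚ.m⊔n≤o⇒m≤o N₁ N₂ N≤m) (ℕₚ.m⊔n≤o⇒m≤o N₁ N₂ N≤n))
             (p₂ m n (ℕₚ.m⊔n≤o⇒n≤o N₁ N₂ N≤m) (ℕₚ.m⊔n≤o⇒n≤o N₁ N₂ N≤n)) ⟩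
      ½ ℚ.* ε ℚ.+ ½ ℚ.* ε
        ≡⟨ trans (sym (ℚₚ.*-distribʳ-+ ε ½ ½)) (ℚₚ.*-identityˡ ε) ⟩
      ε ∎
    where
    open ℚₚ.≤-Reasoning
    half>0 : 0ℚ ℚ.< ½ ℚ.* ε
    half>0 = ℚₚ.positive⁻¹ (½ ℚ.* ε) {{ℚₚ.pos*pos⇒pos ½ ε {{ℚ.positive ε>0}}}}
    boundₛ = smallₛ (½ ℚ.* ε) half>0
    boundₜ = smallₜ (½ ℚ.* ε) half>0
    N₁ = proj₁ boundₛ
    N₂ = proj₁ boundₜ
    p₁ = proj₂ boundₛ
    p₂ = proj₂ boundₜ

  small-* : ∀ {s t} → Bounded s → Small t → Small (λ m n → s m n ℚ.* t m n)
  small-* {s} {t} (B , B>0 , N₁ , b) small ε ε>0 = N₁ ℕ.⊔ N₂ , λ m n N≤m N≤n → begin-strict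
      ℚ.∣ s m n ℚ.* t m n ∣
        ≡⟨ ℚₚ.∣p*q∣≡∣p∣*∣q∣ (s m n) (t m n) ⟩
      ℚ.∣ s m n ∣ ℚ.* ℚ.∣ t m n ∣
        ≤⟨ ℚₚ.*-monoʳ-≤-nonNeg ℚ.∣ t m n ∣ {{ℚ.nonNegative (ℚₚ.0≤∣p∣ (t m n))}}
             (b m n (ℕₚ.m⊔n≤o⇒m≤o N₁ N₂ N≤m) (ℕₚ.m⊔n≤o⇒m≤o N₁ N₂ N≤n)) ⟩
      B ℚ.* ℚ.∣ t m n ∣
        <⟨ ℚₚ.*-monoʳ-<-pos B
             (p m n (ℕₚ.m⊔n≤o⇒n≤o N₁ N₂ N≤m) (ℕₚ.m⊔n≤o⇒n≤o N₁ N₂ N≤n)) ⟩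
      B ℚ.* δ
        ≡⟨ ℚₚ.*-assoc B (ℚ.1/ B) ε ⟨
      B ℚ.* (ℚ.1/ B) ℚ.* ε
        ≡⟨ cong (ℚ._* ε) (ℚₚ.*-inverseʳ B) ⟩
      1ℚ ℚ.* ε
        ≡⟨ ℚₚ.*-identityˡ ε ⟩
      ε ∎
    where
    open ℚₚ.≤-Reasoning
    instance
      B-pos : ℚ.Positive B
      B-pos = ℚ.positive B>0
      B-nonZero : ℚ.NonZero B
      B-nonZero = ℚₚ.pos⇒nonZero B
    δ : ℚ
    δ = ℚ.1/ B ℚ.* ε
    δ>0 : 0ℚ ℚ.< δ
    δ>0 = ℚₚ.positive⁻¹ δ {{ℚₚ.pos*pos⇒pos (ℚ.1/ B) {{ℚₚ.1/pos⇒pos B}} ε {{ℚ.positive ε>0}}}}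
    bound = small δ δ>0
    N₂ = proj₁ bound
    p = proj₂ bound

IsCauchy : (ℕ → ℚ) → Set
IsCauchy s = ∀ ε → 0ℚ ℚ.< ε →
  ∃ λ N → ∀ m n → N ℕ.≤ m → N ℕ.≤ n → ℚ.∣ s m ℚ.- s n ∣ ℚ.< ε

-- Reals are Cauchy sequences of rationals; since there are no quotients, they
-- form a setoid under _≈ᵣ_ rather than a type with _≡_ as its equality.
record ℝ : Set where
  constructor mkℝ
  field
    seq    : ℕ → ℚ
    cauchy : IsCauchy seq

open ℝ public

infix  4 _≈ᵣ_
infixl 6 _+ᵣ_
infixl 7 _*ᵣ_
infix  8 -ᵣ_

record _≈ᵣ_ (x y : ℝ) : Set where
  constructor mk≈
  field
    difference→0 : ∀ ε → 0ℚ ℚ.< ε →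
      ∃ λ N → ∀ n → N ℕ.≤ n → ℚ.∣ seq x n ℚ.- seq y n ∣ ℚ.< ε

open _≈ᵣ_ public

private
  toSmall : ∀ {x y} → x ≈ᵣ y → Small (λ _ n → seq x n ℚ.- seq y n)
  toSmall x≈y ε ε>0 = N , λ _ n _ N≤n → p n N≤n
    where
    N = proj₁ (difference→0 x≈y ε ε>0)
    p = proj₂ (difference→0 x≈y ε ε>0)

  fromSmall : ∀ {x y} → Small (λ _ n → seq x n ℚ.- seq y n) → x ≈ᵣ y
  fromSmall small = mk≈ λ ε ε>0 →
    proj₁ (small ε ε>0) , λ n N≤n → proj₂ (small ε ε>0) n n N≤n N≤n

pointwise⇒≈ᵣ : ∀ {x y} → (∀ n → seq x n ≡ seq y n) → x ≈ᵣ y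
pointwise⇒≈ᵣ {x} {y} x≡y = fromSmall (small-cong
  (λ _ n → trans (sym (ℚₚ.+-inverseʳ (seq y n))) (cong (ℚ._- seq y n) (sym (x≡y n))))
  small-0)

private
  cauchy-bounded : ∀ s → IsCauchy s →
    ∃ λ B → 0ℚ ℚ.< B × ∃ λ N → ∀ n → N ℕ.≤ n → ℚ.∣ s n ∣ ℚ.≤ B
  cauchy-bounded s c =
    1ℚ ℚ.+ ℚ.∣ s N ∣ ,
    ℚₚ.+-mono-<-≤ 1>0 (ℚₚ.0≤∣p∣ (s N)) ,
    N , λ n N≤n → begin
      ℚ.∣ s n ∣                          ≡⟨ cong ℚ.∣_∣ (split (s n) (s N)) ⟩
      ℚ.∣ (s n ℚ.- s N) ℚ.+ s N ∣        ≤⟨ ℚₚ.∣p+q∣≤∣p∣+∣q∣ (s n ℚ.- s N) (s N) ⟩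
      ℚ.∣ s n ℚ.- s N ∣ ℚ.+ ℚ.∣ s N ∣    ≤⟨ ℚₚ.+-monoˡ-≤ ℚ.∣ s N ∣
                                              (ℚₚ.<⇒≤ (proj₂ bound n N N≤n ℕₚ.≤-refl)) ⟩
      1ℚ ℚ.+ ℚ.∣ s N ∣                   ∎
    where
    open ℚₚ.≤-Reasoning
    open +-*-Solver
    1>0 : 0ℚ ℚ.< 1ℚ
    1>0 = ℚₚ.positive⁻¹ 1ℚ
    bound = c 1ℚ 1>0
    N = proj₁ bound
    split : ∀ p q → p ≡ (p ℚ.- q) ℚ.+ q
    split = solve 2 (λ p q → p := (p :- q) :+ q) refl

  boundedˡ : ∀ x → Bounded (λ m _ → seq x m)
  boundedˡ x = proj₁ b , proj₁ (proj₂ b) , proj₁ (proj₂ (proj₂ b)) ,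
    λ m _ N≤m _ → proj₂ (proj₂ (proj₂ b)) m N≤m
    where b = cauchy-bounded (seq x) (cauchy x)

  boundedʳ : ∀ x → Bounded (λ _ n → seq x n)
  boundedʳ x = proj₁ b , proj₁ (proj₂ b) , proj₁ (proj₂ (proj₂ b)) ,
    λ _ n _ N≤n → proj₂ (proj₂ (proj₂ b)) n N≤n
    where b = cauchy-bounded (seq x) (cauchy x)

  +-difference : ∀ p q r s → (p ℚ.- q) ℚ.+ (r ℚ.- s) ≡ (p ℚ.+ r) ℚ.- (q ℚ.+ s)
  +-difference = solve 4 (λ p q r s → (p :- q) :+ (r :- s) := (p :+ r) :- (q :+ s)) refl
    where open +-*-Solver

  *-difference : ∀ p q r s →
    p ℚ.* (r ℚ.- s) ℚ.+ s ℚ.* (p ℚ.- q) ≡ p ℚ.* r ℚ.- q ℚ.* s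
  *-difference = solve 4
    (λ p q r s → p :* (r :- s) :+ s :* (p :- q) := p :* r :- q :* s) refl
    where open +-*-Solver

  neg-difference : ∀ p q → ℚ.- (p ℚ.- q) ≡ (ℚ.- p) ℚ.- (ℚ.- q)
  neg-difference = solve 2 (λ p q → :- (p :- q) := (:- p) :- (:- q)) refl
    where open +-*-Solver

  swap-difference : ∀ p q → ℚ.- (p ℚ.- q) ≡ q ℚ.- p
  swap-difference = solve 2 (λ p q → :- (p :- q) := q :- p) refl
    where open +-*-Solver

  chain-difference : ∀ p q r → (p ℚ.- q) ℚ.+ (q ℚ.- r) ≡ p ℚ.- r
  chain-difference = solve 3 (λ p q r → (p :- q) :+ (q :- r) := p :- r) refl
    where open +-*-Solver

abstract
  const-cauchy : ∀ q → IsCauchy (λ _ → q)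
  const-cauchy q = small-cong (λ _ _ → sym (ℚₚ.+-inverseʳ q)) small-0

  +-cauchy : ∀ x y → IsCauchy (λ n → seq x n ℚ.+ seq y n)
  +-cauchy x y =
    small-cong (λ m n → +-difference (seq x m) (seq x n) (seq y m) (seq y n))
      (small-+ (cauchy x) (cauchy y))

  *-cauchy : ∀ x y → IsCauchy (λ n → seq x n ℚ.* seq y n)
  *-cauchy x y =
    small-cong (λ m n → *-difference (seq x m) (seq x n) (seq y m) (seq y n))
      (small-+ (small-* (boundedˡ x) (cauchy y)) (small-* (boundedʳ y) (cauchy x)))

  neg-cauchy : ∀ x → IsCauchy (λ n → ℚ.- seq x n)
  neg-cauchy x = small-cong (λ m n → neg-difference (seq x m) (seq x n))
    (small-neg (cauchy x))

fromℚ : ℚ → ℝ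
fromℚ q = mkℝ (λ _ → q) (const-cauchy q)

fromℤ : ℤ → ℝ
fromℤ z = fromℚ (z ℚ./ 1)

_+ᵣ_ : ℝ → ℝ → ℝ
x +ᵣ y = mkℝ (λ n → seq x n ℚ.+ seq y n) (+-cauchy x y)

_*ᵣ_ : ℝ → ℝ → ℝ
x *ᵣ y = mkℝ (λ n → seq x n ℚ.* seq y n) (*-cauchy x y)

-ᵣ_ : ℝ → ℝ
-ᵣ x = mkℝ (λ n → ℚ.- seq x n) (neg-cauchy x)

private
  ≈-refl : ∀ {x} → x ≈ᵣ x
  ≈-refl {x} = pointwise⇒≈ᵣ (λ _ → refl)

  ≈-sym : ∀ {x y} → x ≈ᵣ y → y ≈ᵣ x
  ≈-sym {x} {y} x≈y = fromSmall
    (small-cong (λ _ n → swap-difference (seq x n) (seq y n))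
      (small-neg (toSmall x≈y)))

  ≈-trans : ∀ {x y z} → x ≈ᵣ y → y ≈ᵣ z → x ≈ᵣ z
  ≈-trans {x} {y} {z} x≈y y≈z = fromSmall
    (small-cong (λ _ n → chain-difference (seq x n) (seq y n) (seq z n))
      (small-+ (toSmall x≈y) (toSmall y≈z)))

  +-cong : ∀ {x y u v} → x ≈ᵣ y → u ≈ᵣ v → x +ᵣ u ≈ᵣ y +ᵣ v
  +-cong {x} {y} {u} {v} x≈y u≈v = fromSmall
    (small-cong (λ _ n → +-difference (seq x n) (seq y n) (seq u n) (seq v n))
      (small-+ (toSmall x≈y) (toSmall u≈v)))

  *-cong : ∀ {x y u v} → x ≈ᵣ y → u ≈ᵣ v → x *ᵣ u ≈ᵣ y *ᵣ v
  *-cong {x} {y} {u} {v} x≈y u≈v = fromSmall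
    (small-cong (λ _ n → *-difference (seq x n) (seq y n) (seq u n) (seq v n))
      (small-+ (small-* (boundedʳ x) (toSmall u≈v))
               (small-* (boundedʳ v) (toSmall x≈y))))

  neg-cong : ∀ {x y} → x ≈ᵣ y → -ᵣ x ≈ᵣ -ᵣ y
  neg-cong {x} {y} x≈y = fromSmall
    (small-cong (λ _ n → neg-difference (seq x n) (seq y n))
      (small-neg (toSmall x≈y)))

private
  open Algebra.Definitions _≈ᵣ_

  +-assoc : Associative _+ᵣ_
  +-assoc x y z = pointwise⇒≈ᵣ (λ n → ℚₚ.+-assoc (seq x n) (seq y n) (seq z n))

  +-comm : Commutative _+ᵣ_
  +-comm x y = pointwise⇒≈ᵣ (λ n → ℚₚ.+-comm (seq x n) (seq y n))

  +-identityˡ : LeftIdentity (fromℚ 0ℚ) _+ᵣ_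
  +-identityˡ x = pointwise⇒≈ᵣ (λ n → ℚₚ.+-identityˡ (seq x n))

  +-identityʳ : RightIdentity (fromℚ 0ℚ) _+ᵣ_
  +-identityʳ x = pointwise⇒≈ᵣ (λ n → ℚₚ.+-identityʳ (seq x n))

  neg-inverseˡ : LeftInverse (fromℚ 0ℚ) -ᵣ_ _+ᵣ_
  neg-inverseˡ x = pointwise⇒≈ᵣ (λ n → ℚₚ.+-inverseˡ (seq x n))

  neg-inverseʳ : RightInverse (fromℚ 0ℚ) -ᵣ_ _+ᵣ_
  neg-inverseʳ x = pointwise⇒≈ᵣ (λ n → ℚₚ.+-inverseʳ (seq x n))

  *-assoc : Associative _*ᵣ_
  *-assoc x y z = pointwise⇒≈ᵣ (λ n → ℚₚ.*-assoc (seq x n) (seq y n) (seq z n))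

  *-comm : Commutative _*ᵣ_
  *-comm x y = pointwise⇒≈ᵣ (λ n → ℚₚ.*-comm (seq x n) (seq y n))

  *-identityˡ : LeftIdentity (fromℚ 1ℚ) _*ᵣ_
  *-identityˡ x = pointwise⇒≈ᵣ (λ n → ℚₚ.*-identityˡ (seq x n))

  *-identityʳ : RightIdentity (fromℚ 1ℚ) _*ᵣ_
  *-identityʳ x = pointwise⇒≈ᵣ (λ n → ℚₚ.*-identityʳ (seq x n))

  *-distribˡ-+ : _*ᵣ_ DistributesOverˡ _+ᵣ_
  *-distribˡ-+ x y z = pointwise⇒≈ᵣ (λ n → ℚₚ.*-distribˡ-+ (seq x n) (seq y n) (seq z n))

  *-distribʳ-+ : _*ᵣ_ DistributesOverʳ _+ᵣ_
  *-distribʳ-+ x y z = pointwise⇒≈ᵣ (λ n → ℚₚ.*-distribʳ-+ (seq x n) (seq y n) (seq z n))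

ℝ-isCommutativeRing : IsCommutativeRing _≈ᵣ_ _+ᵣ_ _*ᵣ_ -ᵣ_ (fromℚ 0ℚ) (fromℚ 1ℚ)
ℝ-isCommutativeRing = record
  { isRing = record
    { +-isAbelianGroup = record
      { isGroup = record
        { isMonoid = record
          { isSemigroup = record
            { isMagma = record
              { isEquivalence = record
                { refl = ≈-refl ; sym = ≈-sym ; trans = ≈-trans }
              ; ∙-cong = +-cong
              }
            ; assoc = +-assoc
            }
          ; identity = +-identityˡ , +-identityʳ
          }
        ; inverse = neg-inverseˡ , neg-inverseʳ
        ; ⁻¹-cong = neg-cong
        }
      ; comm = +-comm
      }
    ; *-cong = *-cong
    ; *-assoc = *-assoc
    ; *-identity = *-identityˡ , *-identityʳ
    ; distrib = *-distribˡ-+ , *-distribʳ-+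
    }
  ; *-comm = *-comm
  }

ℝ-commutativeRing : CommutativeRing 0ℓ 0ℓ
ℝ-commutativeRing = record { isCommutativeRing = ℝ-isCommutativeRing }

module FormalPowerSeries {c ℓ} (R : CommutativeRing c ℓ) where
  open CommutativeRing R
  open MonoidSum +-monoid using (sum⁺-syntax)

  -- g n is the coefficient of xⁿ.
  Series : Set c
  Series = ℕ → Carrier

  infix  4 _≋_
  infixl 7 _⊛_
  infixr 8 _^ₛ_
  infixr 9 _∘ₛ_

  _≋_ : Series → Series → Set ℓ
  g ≋ h = ∀ n → g n ≈ h n

  1ₛ : Series
  1ₛ zero    = 1#
  1ₛ (suc _) = 0#

  _⊛_ : Series → Series → Series
  (g ⊛ h) n = ∑[ i ≤ n ] (g (toℕ i) * h (n ℕ.∸ toℕ i))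

  _^ₛ_ : Series → ℕ → Series
  h ^ₛ zero  = 1ₛ
  h ^ₛ suc k = h ⊛ h ^ₛ k

  -- The composite g(h(x)) = Σₖ g(k) h(x)ᵏ, meaningful only when h has zero
  -- constant term: then h(x)ᵏ has no xⁿ term for k > n, so that the
  -- coefficient of xⁿ is the finite sum over k ≤ n.
  _∘ₛ_ : Series → Series → Series
  (g ∘ₛ h) n = ∑[ k ≤ n ] (g (toℕ k) * (h ^ₛ toℕ k) n)

open FormalPowerSeries ℝ-commutativeRing public

-- F(4x)/4 = Σₙ﹥₀ 4ⁿ⁻¹ f(n) xⁿ, for F(x) = Σₙ﹥₀ f(n) xⁿ.
infix 10 _[4x]/4

_[4x]/4 : (ℕ → ℤ) → (ℕ → ℤ)
(f [4x]/4) zero    = ℤ.0ℤ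
(f [4x]/4) (suc n) = ℤ.+ (4 ℕ.^ n) ℤ.* f (suc n)

{-# OPTIONS --safe #-}
-- Let S be the matrix whose (i , k) entry is the coefficient of xⁱ in A(x)ᵏ.
-- It is lower unitriangular, and since g ↦ g ∘ A is multiplicative, S² is the
-- matrix belonging to A ∘ A. The coefficients of F(4x)/4 beyond the linear one
-- are multiples of 4, hence so are the entries of S² below the diagonal.
-- For k < i the (i , k) entry of S² is 2 Sᵢₖ + Σ Sᵢⱼ Sⱼₖ over k < j < i, so
-- induction on i − k shows that Sᵢₖ is an even integer; A is the column k = 1.
module Submission where

open import Algebra.Bundles using (CommutativeRing)
import Algebra.Properties.AbelianGroup as AbelianGroupProperties
import Algebra.Properties.Semiring.Sum as SemiringSum
open import Data.Fin.Base using (Fin; zero; suc; toℕ; fromℕ; fromℕ<; inject₁; punchIn)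
import Data.Fin.Properties as Finₚ
import Data.Integer.Base as ℤ
import Data.Integer.Properties as ℤₚ
import Data.Integer.Tactic.RingSolver as ℤSolver
import Data.Nat.Base as ℕ
open import Data.Nat.Base using (zero; suc; _<_; z≤n; s≤s)
import Data.Nat.Properties as ℕₚ
open import Data.Product.Base using (_,_)
open import Data.Rational.Base using (½)
import Data.Rational.Base as ℚ
import Data.Rational.Properties as ℚₚ
import Data.Rational.Unnormalised.Base as ℚᵘ
import Data.Rational.Unnormalised.Properties as ℚᵘₚ
open import Data.Vec.Functional using (Vector; init; last; removeAt)
open import Function.Base using (_∘_)
import Relation.Binary.Reasoning.Setoid as SetoidReasoning
open import Relation.Binary.Definitions using (tri<; tri≈; tri>)
open import Relation.Nullary.Negation using (contradiction)
import Relation.Binary.PropositionalEquality as ≡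

open import Defs using (module FormalPowerSeries)
open import Data.Nat.Base using (ℕ; _≤_)
open import Relation.Binary.PropositionalEquality using (_≡_)

-- Formal power series over a commutative ring: products, powers, composition.

module PowerSeriesProperties {c ℓ} (R : CommutativeRing c ℓ) where
  open CommutativeRing R
  open FormalPowerSeries R
  open SemiringSum semiring
  open SetoidReasoning setoid

  -- Every g is g(0) + x · `shift g`. Sums over `Fin` peel off their head, so `(g ⊛ h) (suc n)` is
  -- by definition `g 0 * h (suc n) + (shift g ⊛ h) n`; the inductions below run on this.
  shift : Series → Series
  shift g n = g (suc n)

  sum-≈0 : ∀ {n} {t : Vector Carrier n} → (∀ i → t i ≈ 0#) → sum t ≈ 0#
  sum-≈0 {n} t≈0 = trans (sum-cong-≋ {n} t≈0) (sum-replicate-zero n)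

  sum-linear : ∀ {n} x (s t : Vector Carrier n) →
    ∑[ i < n ] (x * s i + t i) ≈ x * sum s + sum t
  sum-linear x s t =
    trans (∑-distrib-+ (λ i → x * s i) t) (+-congʳ (sym (*-distribˡ-sum x s)))

  sum-extend : ∀ {m n} (t : ℕ → Carrier) → m ≤ n → (∀ k → m ≤ k → t k ≈ 0#) →
    ∑[ i < m ] t (toℕ i) ≈ ∑[ i < n ] t (toℕ i)
  sum-extend {n = n} t z≤n       t≈0 = sym (sum-≈0 {n} (λ i → t≈0 (toℕ i) z≤n))
  sum-extend         t (s≤s m≤n) t≈0 =
    +-congˡ (sum-extend (shift t) m≤n (λ k m≤k → t≈0 (suc k) (s≤s m≤k)))

  ⊛-cong : ∀ {g g′ h h′} → g ≋ g′ → h ≋ h′ → g ⊛ h ≋ g′ ⊛ h′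
  ⊛-cong g≋g′ h≋h′ n =
    sum-cong-≋ {suc n} (λ i → *-cong (g≋g′ (toℕ i)) (h≋h′ (n ℕ.∸ toℕ i)))

  ⊛-congˡ-≤ : ∀ g {h h′} n → (∀ m → m ≤ n → h m ≈ h′ m) → (g ⊛ h) n ≈ (g ⊛ h′) n
  ⊛-congˡ-≤ g n h≈h′ =
    sum-cong-≋ {suc n} (λ i → *-congˡ {g (toℕ i)} (h≈h′ (n ℕ.∸ toℕ i) (ℕₚ.m∸n≤m n (toℕ i))))

  *-linearˡ : ∀ x y z w → (x * y + z) * w ≈ x * (y * w) + z * w
  *-linearˡ x y z w = trans (distribʳ w (x * y) z) (+-congʳ (*-assoc x y w))

  *-linearʳ : ∀ x y z w → w * (x * y + z) ≈ x * (w * y) + w * z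
  *-linearʳ x y z w = trans (distribˡ w (x * y) z) (+-congʳ (begin
    w * (x * y)  ≈⟨ *-assoc w x y ⟨
    w * x * y    ≈⟨ *-congʳ (*-comm w x) ⟩
    x * w * y    ≈⟨ *-assoc x w y ⟩
    x * (w * y)  ∎))

  -- Scaling and addition are treated together because `shift (g ⊛ h)` unfolds to exactly this
  -- shape, with `x = g 0`.
  ⊛-linearˡ : ∀ x g h k → (λ n → x * g n + h n) ⊛ k ≋ (λ n → x * (g ⊛ k) n + (h ⊛ k) n)
  ⊛-linearˡ x g h k n = trans
    (sum-cong-≋ {suc n} (λ i → *-linearˡ x (g (toℕ i)) (h (toℕ i)) (k (n ℕ.∸ toℕ i))))
    (sum-linear {suc n} x (λ i → g (toℕ i) * k (n ℕ.∸ toℕ i)) (λ i → h (toℕ i) * k (n ℕ.∸ toℕ i)))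

  ⊛-linearʳ : ∀ x g h k → k ⊛ (λ n → x * g n + h n) ≋ (λ n → x * (k ⊛ g) n + (k ⊛ h) n)
  ⊛-linearʳ x g h k n = trans
    (sum-cong-≋ {suc n} (λ i → *-linearʳ x (g (n ℕ.∸ toℕ i)) (h (n ℕ.∸ toℕ i)) (k (toℕ i))))
    (sum-linear {suc n} x (λ i → k (toℕ i) * g (n ℕ.∸ toℕ i)) (λ i → k (toℕ i) * h (n ℕ.∸ toℕ i)))

  ∘-linearˡ : ∀ x g h a → (λ n → x * g n + h n) ∘ₛ a ≋ (λ n → x * (g ∘ₛ a) n + (h ∘ₛ a) n)
  ∘-linearˡ x g h a n = trans
    (sum-cong-≋ {suc n} (λ i → *-linearˡ x (g (toℕ i)) (h (toℕ i)) ((a ^ₛ toℕ i) n)))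
    (sum-linear {suc n} x (λ i → g (toℕ i) * (a ^ₛ toℕ i) n) (λ i → h (toℕ i) * (a ^ₛ toℕ i) n))

  ⊛-identityˡ : ∀ g → 1ₛ ⊛ g ≋ g
  ⊛-identityˡ g n = begin
    1# * g n + _  ≈⟨ +-cong (*-identityˡ (g n)) (sum-≈0 {n} (λ i → zeroˡ _)) ⟩
    g n + 0#      ≈⟨ +-identityʳ (g n) ⟩
    g n           ∎

  ⊛-identityʳ : ∀ g → g ⊛ 1ₛ ≋ g
  ⊛-identityʳ g zero    = trans (+-identityʳ _) (*-identityʳ (g 0))
  ⊛-identityʳ g (suc n) = begin
    g 0 * 0# + (shift g ⊛ 1ₛ) n  ≈⟨ +-cong (zeroʳ (g 0)) (⊛-identityʳ (shift g) n) ⟩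
    0# + g (suc n)               ≈⟨ +-identityˡ (g (suc n)) ⟩
    g (suc n)                    ∎

  -- Induction on the coefficient: splitting off g(0) leaves the same claim for `shift g`, one
  -- degree lower.
  ⊛-assoc : ∀ g h k → (g ⊛ h) ⊛ k ≋ g ⊛ (h ⊛ k)
  ⊛-assoc g h k zero = begin
    (g 0 * h 0 + 0#) * k 0 + 0#  ≈⟨ +-congʳ (*-congʳ (+-identityʳ _)) ⟩
    g 0 * h 0 * k 0 + 0#         ≈⟨ +-congʳ (*-assoc _ _ _) ⟩
    g 0 * (h 0 * k 0) + 0#       ≈⟨ +-congʳ (*-congˡ (+-identityʳ _)) ⟨
    g 0 * (h 0 * k 0 + 0#) + 0#  ∎
  ⊛-assoc g h k (suc n) = begin
    (g 0 * h 0 + 0#) * k (suc n) + ((λ m → g 0 * shift h m + (shift g ⊛ h) m) ⊛ k) n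
      ≈⟨ +-cong (*-congʳ (+-identityʳ _)) (⊛-linearˡ (g 0) (shift h) (shift g ⊛ h) k n) ⟩
    g 0 * h 0 * k (suc n) + (g 0 * (shift h ⊛ k) n + ((shift g ⊛ h) ⊛ k) n)
      ≈⟨ +-cong (*-assoc _ _ _) (+-congˡ (⊛-assoc (shift g) h k n)) ⟩
    g 0 * (h 0 * k (suc n)) + (g 0 * (shift h ⊛ k) n + (shift g ⊛ (h ⊛ k)) n)
      ≈⟨ +-assoc _ _ _ ⟨
    g 0 * (h 0 * k (suc n)) + g 0 * (shift h ⊛ k) n + (shift g ⊛ (h ⊛ k)) n
      ≈⟨ +-congʳ (distribˡ (g 0) _ _) ⟨
    g 0 * (h ⊛ k) (suc n) + (shift g ⊛ (h ⊛ k)) n ∎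

  ^-cong : ∀ {g h} k → g ≋ h → g ^ₛ k ≋ h ^ₛ k
  ^-cong zero    g≋h n = refl
  ^-cong (suc k) g≋h   = ⊛-cong g≋h (^-cong k g≋h)

  ∘-homo-1ₛ : ∀ a → 1ₛ ∘ₛ a ≋ 1ₛ
  ∘-homo-1ₛ a n = trans
    (+-cong (*-identityˡ (1ₛ n)) (sum-≈0 {n} (λ i → zeroˡ _)))
    (+-identityʳ (1ₛ n))

  -- Series without constant term.

  module _ (a : Series) (a₀≈0 : a 0 ≈ 0#) where
    ⊛-suc : ∀ h n → (a ⊛ h) (suc n) ≈ (shift a ⊛ h) n
    ⊛-suc h n =
      trans (+-congʳ (trans (*-congʳ a₀≈0) (zeroˡ (h (suc n))))) (+-identityˡ _)

    ⊛-zero : ∀ h → (a ⊛ h) 0 ≈ 0#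
    ⊛-zero h =
      trans (+-identityʳ _) (trans (*-congʳ a₀≈0) (zeroˡ (h 0)))

    -- Since a = x · `shift a`, multiplying by `a` raises degrees. The strict bound makes both the
    -- truncation in `∘-unfold` and the induction in `∘-homo-⊛-<` work.
    ⊛-congˡ-< : ∀ {h h′} n → (∀ m → m < n → h m ≈ h′ m) → (a ⊛ h) n ≈ (a ⊛ h′) n
    ⊛-congˡ-< {h} {h′} zero    _    = trans (⊛-zero h) (sym (⊛-zero h′))
    ⊛-congˡ-< {h} {h′} (suc n) h≈h′ = begin
      (a ⊛ h) (suc n)   ≈⟨ ⊛-suc h n ⟩
      (shift a ⊛ h) n   ≈⟨ ⊛-congˡ-≤ (shift a) n (λ m m≤n → h≈h′ m (s≤s m≤n)) ⟩
      (shift a ⊛ h′) n  ≈⟨ ⊛-suc h′ n ⟨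
      (a ⊛ h′) (suc n)  ∎

    -- The power is divisible by xᵏ, as `a` is divisible by x. This is the triangularity of S.
    ^-vanish : ∀ {m k} → m < k → (a ^ₛ k) m ≈ 0#
    ^-vanish {zero}  {suc k} _         = ⊛-zero (a ^ₛ k)
    ^-vanish {suc m} {suc k} (s≤s m<k) = begin
      (a ⊛ a ^ₛ k) (suc m)    ≈⟨ ⊛-suc (a ^ₛ k) m ⟩
      (shift a ⊛ a ^ₛ k) m    ≈⟨ sum-≈0 {suc m} (λ i → trans
                                   (*-congˡ {shift a (toℕ i)} (^-vanish (ℕₚ.≤-<-trans (ℕₚ.m∸n≤m m (toℕ i)) m<k)))
                                   (zeroʳ _)) ⟩
      0#                      ∎

    ^-diagonal : a 1 ≈ 1# → ∀ k → (a ^ₛ k) k ≈ 1#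
    ^-diagonal a₁≈1 zero    = refl
    ^-diagonal a₁≈1 (suc k) = begin
      (a ⊛ a ^ₛ k) (suc k)    ≈⟨ ⊛-suc (a ^ₛ k) k ⟩
      a 1 * (a ^ₛ k) k + _    ≈⟨ +-cong (*-cong a₁≈1 (^-diagonal a₁≈1 k))
                                   (sum-≈0 {k} (λ i → trans
                                     (*-congˡ (^-vanish (ℕₚ.∸-monoʳ-< (s≤s z≤n) (Finₚ.toℕ<n i))))
                                     (zeroʳ _))) ⟩
      1# * 1# + 0#            ≈⟨ trans (+-identityʳ _) (*-identityˡ 1#) ⟩
      1#                      ∎

    -- One step of Horner's scheme: substitute `a` into g(0) + x · `shift g`, taking one factor `a`
    -- out of each positive power.
    ∘-unfold : ∀ g → g ∘ₛ a ≋ (λ n → g 0 * 1ₛ n + (a ⊛ (shift g ∘ₛ a)) n)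
    ∘-unfold g n = +-congˡ (begin
      ∑[ k < n ] (g′ (toℕ k) * ∑[ i ≤ n ] (a (toℕ i) * (a ^ₛ toℕ k) (n ℕ.∸ toℕ i)))
        ≈⟨ sum-cong-≋ {n} (λ k → *-distribˡ-sum {suc n} (g′ (toℕ k))
             (λ i → a (toℕ i) * (a ^ₛ toℕ k) (n ℕ.∸ toℕ i))) ⟩
      ∑[ k < n ] ∑[ i ≤ n ] (g′ (toℕ k) * (a (toℕ i) * (a ^ₛ toℕ k) (n ℕ.∸ toℕ i)))
        ≈⟨ ∑-comm {n} {suc n} (λ k i → g′ (toℕ k) * (a (toℕ i) * (a ^ₛ toℕ k) (n ℕ.∸ toℕ i))) ⟩
      ∑[ i ≤ n ] ∑[ k < n ] (g′ (toℕ k) * (a (toℕ i) * (a ^ₛ toℕ k) (n ℕ.∸ toℕ i)))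
        ≈⟨ sum-cong-≋ {suc n} (λ i → trans
             (sum-cong-≋ {n} (λ k → x*[y*z]≈y*[x*z] (g′ (toℕ k)) (a (toℕ i)) ((a ^ₛ toℕ k) (n ℕ.∸ toℕ i))))
             (sym (*-distribˡ-sum {n} (a (toℕ i)) _))) ⟩
      (a ⊛ (λ m → ∑[ k < n ] (g′ (toℕ k) * (a ^ₛ toℕ k) m))) n
        -- Here k runs below n, whereas coefficient m of the composite stops at k = m. For m < n the
        -- surplus terms vanish; m = n, where the range would be one term short, never arises.
        ≈⟨ ⊛-congˡ-< n (λ m m<n → sym (sum-extend (λ k → g′ k * (a ^ₛ k) m) m<n
             (λ k m<k → trans (*-congˡ (^-vanish m<k)) (zeroʳ _)))) ⟩
      (a ⊛ (g′ ∘ₛ a)) n ∎)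
      where
      g′ = shift g
      x*[y*z]≈y*[x*z] : ∀ x y z → x * (y * z) ≈ y * (x * z)
      x*[y*z]≈y*[x*z] x y z =
        trans (sym (*-assoc x y z)) (trans (*-congʳ (*-comm x y)) (*-assoc y x z))

    -- With g = g(0) + x g′ both sides unfold to g(0) (h ∘ a) + a · (g′h ∘ a); the factor a
    -- has no constant term, so the nth coefficient involves only lower ones of g′h ∘ a.
    ∘-homo-⊛-< : ∀ N g h n → n < N →
      ((g ⊛ h) ∘ₛ a) n ≈ ((g ∘ₛ a) ⊛ (h ∘ₛ a)) n
    ∘-homo-⊛-< (suc N) g h n (s≤s n≤N) = begin
      ((g ⊛ h) ∘ₛ a) n
        ≈⟨ ∘-unfold (g ⊛ h) n ⟩
      (g 0 * h 0 + 0#) * 1ₛ n + (a ⊛ ((λ m → g 0 * h′ m + (g′ ⊛ h) m) ∘ₛ a)) n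
        ≈⟨ +-cong (trans (*-congʳ (+-identityʳ _)) (*-assoc _ _ _))
             (⊛-congˡ-< n (λ m m<n → trans (∘-linearˡ (g 0) h′ (g′ ⊛ h) a m)
               (+-congˡ (∘-homo-⊛-< N g′ h m (ℕₚ.<-≤-trans m<n n≤N))))) ⟩
      g 0 * (h 0 * 1ₛ n) + (a ⊛ (λ m → g 0 * (h′ ∘ₛ a) m + ((g′ ∘ₛ a) ⊛ (h ∘ₛ a)) m)) n
        ≈⟨ +-congˡ (⊛-linearʳ (g 0) (h′ ∘ₛ a) ((g′ ∘ₛ a) ⊛ (h ∘ₛ a)) a n) ⟩
      g 0 * (h 0 * 1ₛ n) + (g 0 * (a ⊛ (h′ ∘ₛ a)) n + (a ⊛ ((g′ ∘ₛ a) ⊛ (h ∘ₛ a))) n)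
        ≈⟨ trans (sym (+-assoc _ _ _)) (+-congʳ (sym (distribˡ (g 0) _ _))) ⟩
      g 0 * (h 0 * 1ₛ n + (a ⊛ (h′ ∘ₛ a)) n) + (a ⊛ ((g′ ∘ₛ a) ⊛ (h ∘ₛ a))) n
        ≈⟨ +-cong (*-congˡ (sym (∘-unfold h n))) (sym (⊛-assoc a (g′ ∘ₛ a) (h ∘ₛ a) n)) ⟩
      g 0 * (h ∘ₛ a) n + ((a ⊛ (g′ ∘ₛ a)) ⊛ (h ∘ₛ a)) n
        -- Inserting `1ₛ` lets linearity merge both terms into one product, whose left factor is the
        -- unfolding of `g ∘ₛ a`.
        ≈⟨ +-congʳ (*-congˡ (⊛-identityˡ (h ∘ₛ a) n)) ⟨
      g 0 * (1ₛ ⊛ (h ∘ₛ a)) n + ((a ⊛ (g′ ∘ₛ a)) ⊛ (h ∘ₛ a)) n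
        ≈⟨ ⊛-linearˡ (g 0) 1ₛ (a ⊛ (g′ ∘ₛ a)) (h ∘ₛ a) n ⟨
      ((λ m → g 0 * 1ₛ m + (a ⊛ (g′ ∘ₛ a)) m) ⊛ (h ∘ₛ a)) n
        ≈⟨ ⊛-cong {h = h ∘ₛ a} (λ m → sym (∘-unfold g m)) (λ _ → refl) n ⟩
      ((g ∘ₛ a) ⊛ (h ∘ₛ a)) n ∎
      where
      g′ = shift g
      h′ = shift h

    ∘-homo-⊛ : ∀ g h → (g ⊛ h) ∘ₛ a ≋ (g ∘ₛ a) ⊛ (h ∘ₛ a)
    ∘-homo-⊛ g h n = ∘-homo-⊛-< (suc n) g h n ℕₚ.≤-refl

    -- For `g = a` the left side lists column k of S², and the right side column k of the matrix of
    -- A ∘ A.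
    ∘-homo-^ : ∀ g k → (g ^ₛ k) ∘ₛ a ≋ (g ∘ₛ a) ^ₛ k
    ∘-homo-^ g zero    n = ∘-homo-1ₛ a n
    ∘-homo-^ g (suc k) n = trans
      (∘-homo-⊛ g (g ^ₛ k) n)
      (⊛-cong {g = g ∘ₛ a} (λ _ → refl) (∘-homo-^ g k) n)

open import Defs
open import Data.Integer.Base using (ℤ; 0ℤ; 1ℤ)
open import Data.Product.Base using (∃)

private
  module R where
    open CommutativeRing ℝ-commutativeRing public
    open AbelianGroupProperties +-abelianGroup public
    open SemiringSum semiring public
  open PowerSeriesProperties ℝ-commutativeRing
  open SetoidReasoning R.setoid

-- Integers and their multiples inside the reals.

fromℚᵘ-homo-+ : ∀ p q → ℚ.fromℚᵘ (p ℚᵘ.+ q) ≡ ℚ.fromℚᵘ p ℚ.+ ℚ.fromℚᵘ q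
fromℚᵘ-homo-+ p q = ℚₚ.toℚᵘ-injective (ℚᵘₚ.≃-trans (ℚₚ.toℚᵘ-fromℚᵘ (p ℚᵘ.+ q))
  (ℚᵘₚ.≃-sym (ℚᵘₚ.≃-trans (ℚₚ.toℚᵘ-homo-+ (ℚ.fromℚᵘ p) (ℚ.fromℚᵘ q))
    (ℚᵘₚ.+-cong (ℚₚ.toℚᵘ-fromℚᵘ p) (ℚₚ.toℚᵘ-fromℚᵘ q)))))

fromℚᵘ-homo-* : ∀ p q → ℚ.fromℚᵘ (p ℚᵘ.* q) ≡ ℚ.fromℚᵘ p ℚ.* ℚ.fromℚᵘ q
fromℚᵘ-homo-* p q = ℚₚ.toℚᵘ-injective (ℚᵘₚ.≃-trans (ℚₚ.toℚᵘ-fromℚᵘ (p ℚᵘ.* q))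
  (ℚᵘₚ.≃-sym (ℚᵘₚ.≃-trans (ℚₚ.toℚᵘ-homo-* (ℚ.fromℚᵘ p) (ℚ.fromℚᵘ q))
    (ℚᵘₚ.*-cong (ℚₚ.toℚᵘ-fromℚᵘ p) (ℚₚ.toℚᵘ-fromℚᵘ q)))))

fromℤ-cong : ∀ {x y} → x ≡ y → fromℤ x ≈ᵣ fromℤ y
fromℤ-cong ≡.refl = R.refl

-- `z ℚ./ 1` is the normalisation of `mkℚᵘ z 0`. Adding such fractions cross-multiplies by the
-- denominators 1, whence the uses of `*-identityʳ`.
fromℤ-homo-+ : ∀ x y → fromℤ (x ℤ.+ y) ≈ᵣ fromℤ x +ᵣ fromℤ y
fromℤ-homo-+ x y = pointwise⇒≈ᵣ (λ _ → ≡.trans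
  (≡.cong (ℚ._/ 1) (≡.sym (≡.cong₂ ℤ._+_ (ℤₚ.*-identityʳ x) (ℤₚ.*-identityʳ y))))
  (fromℚᵘ-homo-+ (ℚᵘ.mkℚᵘ x 0) (ℚᵘ.mkℚᵘ y 0)))

fromℤ-homo-* : ∀ x y → fromℤ (x ℤ.* y) ≈ᵣ fromℤ x *ᵣ fromℤ y
fromℤ-homo-* x y = pointwise⇒≈ᵣ (λ _ → fromℚᵘ-homo-* (ℚᵘ.mkℚᵘ x 0) (ℚᵘ.mkℚᵘ y 0))

-- 2 is invertible in the reals, so both sides can be multiplied by `½`.
+ᵣ-cancel-double : ∀ {x y} → x +ᵣ x ≈ᵣ y +ᵣ y → x ≈ᵣ y
+ᵣ-cancel-double {x} {y} x+x≈y+y = begin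
  x                     ≈⟨ half-double x ⟨
  fromℚ ½ *ᵣ (x +ᵣ x)   ≈⟨ R.*-congˡ x+x≈y+y ⟩
  fromℚ ½ *ᵣ (y +ᵣ y)   ≈⟨ half-double y ⟩
  y                     ∎
  where
  half-double : ∀ z → fromℚ ½ *ᵣ (z +ᵣ z) ≈ᵣ z
  half-double z = begin
    fromℚ ½ *ᵣ (z +ᵣ z)            ≈⟨ R.distribˡ (fromℚ ½) z z ⟩
    fromℚ ½ *ᵣ z +ᵣ fromℚ ½ *ᵣ z   ≈⟨ R.distribʳ z (fromℚ ½) (fromℚ ½) ⟨
    (fromℚ ½ +ᵣ fromℚ ½) *ᵣ z      ≈⟨ R.*-congʳ (pointwise⇒≈ᵣ (λ _ → ≡.refl)) ⟩
    R.1# *ᵣ z                      ≈⟨ R.*-identityˡ z ⟩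
    z                              ∎

-- A record rather than a Σ-type, so that m and x can be inferred.
record Multiple (m : ℤ) (x : ℝ) : Set where
  constructor multiple
  field
    quotient : ℤ
    equality : x ≈ᵣ fromℤ (m ℤ.* quotient)

multiple-cong : ∀ {m x y} → x ≈ᵣ y → Multiple m x → Multiple m y
multiple-cong x≈y (multiple z x≈mz) = multiple z (R.trans (R.sym x≈y) x≈mz)

-- `Multiple 1ℤ` serves as the predicate of being an integer, so one set of closure rules covers
-- both notions.
multiple⇒integer : ∀ {m x} → Multiple m x → Multiple 1ℤ x
multiple⇒integer {m} (multiple z x≈mz) =
  multiple (m ℤ.* z) (R.trans x≈mz (fromℤ-cong (≡.sym (ℤₚ.*-identityˡ (m ℤ.* z)))))

multiple-0 : ∀ {m x} → x ≈ᵣ R.0# → Multiple m x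
multiple-0 {m} x≈0 = multiple 0ℤ (R.trans x≈0 (fromℤ-cong (≡.sym (ℤₚ.*-zeroʳ m))))

integer-1 : ∀ {x} → x ≈ᵣ R.1# → Multiple 1ℤ x
integer-1 x≈1 = multiple 1ℤ x≈1

multiple-+ : ∀ {m x y} → Multiple m x → Multiple m y → Multiple m (x +ᵣ y)
multiple-+ {m} {x} {y} (multiple z x≈mz) (multiple w y≈mw) = multiple (z ℤ.+ w) (begin
  x +ᵣ y                               ≈⟨ R.+-cong x≈mz y≈mw ⟩
  fromℤ (m ℤ.* z) +ᵣ fromℤ (m ℤ.* w)   ≈⟨ fromℤ-homo-+ (m ℤ.* z) (m ℤ.* w) ⟨
  fromℤ (m ℤ.* z ℤ.+ m ℤ.* w)          ≈⟨ fromℤ-cong (ℤₚ.*-distribˡ-+ m z w) ⟨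
  fromℤ (m ℤ.* (z ℤ.+ w))              ∎)

-- The moduli multiply, so that a product of two even entries of S is divisible by 4.
multiple-* : ∀ {m n x y} → Multiple m x → Multiple n y → Multiple (m ℤ.* n) (x *ᵣ y)
multiple-* {m} {n} {x} {y} (multiple z x≈mz) (multiple w y≈nw) = multiple (z ℤ.* w) (begin
  x *ᵣ y                               ≈⟨ R.*-cong x≈mz y≈nw ⟩
  fromℤ (m ℤ.* z) *ᵣ fromℤ (n ℤ.* w)   ≈⟨ fromℤ-homo-* (m ℤ.* z) (n ℤ.* w) ⟨
  fromℤ (m ℤ.* z ℤ.* (n ℤ.* w))        ≈⟨ fromℤ-cong (interchange m z n w) ⟩
  fromℤ (m ℤ.* n ℤ.* (z ℤ.* w))        ∎)
  where
  interchange : ∀ m z n w → m ℤ.* z ℤ.* (n ℤ.* w) ≡ m ℤ.* n ℤ.* (z ℤ.* w)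
  interchange = ℤSolver.solve-∀

multiple-*ˡ : ∀ {m x y} → Multiple 1ℤ x → Multiple m y → Multiple m (x *ᵣ y)
multiple-*ˡ {m} {x} {y} p q =
  ≡.subst (λ n → Multiple n (x *ᵣ y)) (ℤₚ.*-identityˡ m) (multiple-* p q)

multiple-cancelʳ : ∀ {m x y} → Multiple m y → Multiple m (x +ᵣ y) → Multiple m x
multiple-cancelʳ {m} {x} {y} (multiple w y≈mw) (multiple z x+y≈mz) = multiple (z ℤ.- w)
  (R.∙-cancelʳ y x (fromℤ (m ℤ.* (z ℤ.- w))) (begin
    x +ᵣ y                                       ≈⟨ x+y≈mz ⟩
    fromℤ (m ℤ.* z)                              ≈⟨ fromℤ-cong (split m z w) ⟩
    fromℤ (m ℤ.* (z ℤ.- w) ℤ.+ m ℤ.* w)          ≈⟨ fromℤ-homo-+ (m ℤ.* (z ℤ.- w)) (m ℤ.* w) ⟩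
    fromℤ (m ℤ.* (z ℤ.- w)) +ᵣ fromℤ (m ℤ.* w)   ≈⟨ R.+-congˡ y≈mw ⟨
    fromℤ (m ℤ.* (z ℤ.- w)) +ᵣ y                 ∎))
  where
  split : ∀ m z w → m ℤ.* z ≡ m ℤ.* (z ℤ.- w) ℤ.+ m ℤ.* w
  split = ℤSolver.solve-∀

-- Of the two factors 2 one is spent on the division; the other keeps the result even, as the
-- induction in `^-even` requires.
multiple-halve : ∀ {x} → Multiple (ℤ.+ 4) (x +ᵣ x) → Multiple (ℤ.+ 2) x
multiple-halve {x} (multiple z x+x≈4z) = multiple z (+ᵣ-cancel-double (begin
  x +ᵣ x                                       ≈⟨ x+x≈4z ⟩
  fromℤ (ℤ.+ 4 ℤ.* z)                          ≈⟨ fromℤ-cong (double z) ⟩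
  fromℤ (ℤ.+ 2 ℤ.* z ℤ.+ ℤ.+ 2 ℤ.* z)          ≈⟨ fromℤ-homo-+ (ℤ.+ 2 ℤ.* z) (ℤ.+ 2 ℤ.* z) ⟩
  fromℤ (ℤ.+ 2 ℤ.* z) +ᵣ fromℤ (ℤ.+ 2 ℤ.* z)   ∎))
  where
  double : ∀ z → ℤ.+ 4 ℤ.* z ≡ ℤ.+ 2 ℤ.* z ℤ.+ ℤ.+ 2 ℤ.* z
  double = ℤSolver.solve-∀

multiple-sum : ∀ {m n} {t : Vector ℝ n} → (∀ i → Multiple m (t i)) → Multiple m (R.sum t)
multiple-sum {n = zero}  p = multiple-0 R.refl
multiple-sum {n = suc n} p = multiple-+ (p zero) (multiple-sum (p ∘ suc))

^-integer : ∀ {g} → (∀ n → Multiple 1ℤ (g n)) → ∀ k n → Multiple 1ℤ ((g ^ₛ k) n)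
^-integer p zero    zero    = integer-1 R.refl
^-integer p zero    (suc n) = multiple-0 R.refl
^-integer p (suc k) n       =
  multiple-sum {n = suc n} (λ i → multiple-* (p (toℕ i)) (^-integer p k (n ℕ.∸ toℕ i)))

-- Divisibility of matrix entries below the diagonal.

module _ (g : Series) (g₀≈0 : g 0 ≈ᵣ R.0#) (g₁≈1 : g 1 ≈ᵣ R.1#) where

  -- Modulo m the series is x, so its kth power is xᵏ.
  ^-multiple : ∀ {m} → (∀ n → Multiple m (g (2 ℕ.+ n))) →
    ∀ k i → k < i → Multiple m ((g ^ₛ k) i)
  ^-multiple     p zero    (suc i) _         = multiple-0 R.refl
  ^-multiple {m} p (suc k) (suc i) (s≤s k<i) = multiple-cong
    (R.sym (⊛-suc g g₀≈0 (g ^ₛ k) i))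
    (multiple-+
      -- The head term has the factor g(1) = 1 and an entry still below the diagonal; every other
      -- term has a factor g(2 + j).
      (multiple-*ˡ (integer-1 g₁≈1) (^-multiple p k i k<i))
      (multiple-sum {n = i} (λ j → multiple-cong (R.*-comm _ _)
        (multiple-*ˡ (^-integer integer k (i ℕ.∸ suc (toℕ j))) (p (toℕ j))))))
    where
    integer : ∀ n → Multiple 1ℤ (g n)
    integer 0             = multiple-0 g₀≈0
    integer 1             = integer-1 g₁≈1
    integer (suc (suc n)) = multiple⇒integer (p n)

  -- `N` bounds the distance to the diagonal. All columns are treated at once, since an entry of one
  -- column involves entries of others. Evenness is proved because integrality alone would not make
  -- 2 Sᵢₖ divisible by 2.
  ^-even : (∀ k i → k < i → Multiple (ℤ.+ 4) (((g ∘ₛ g) ^ₛ k) i)) →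
    ∀ N k i → k < i → i ℕ.∸ k ≤ N → Multiple (ℤ.+ 2) ((g ^ₛ k) i)
  ^-even p zero    k i         k<i i∸k≤0 = contradiction i∸k≤0 (ℕₚ.<⇒≱ (ℕₚ.m<n⇒0<n∸m k<i))
  -- The pattern `suc n` gives `s` a successor length, as `removeAt` demands.
  ^-even p (suc N) k i@(suc n) k<i i∸k≤N = multiple-halve (multiple-cancelʳ
    (multiple-sum {t = removeAt s κ} (λ j → off-diagonal _ (inject₁<i (punchIn κ j)) (≢k j)))
    (multiple-cong decompose (p k i k<i)))
    where
    x : ℝ
    x = (g ^ₛ k) i
    u : ℕ → ℝ
    u j = (g ^ₛ k) j *ᵣ (g ^ₛ j) i
    t : Vector ℝ (suc i)
    t = u ∘ toℕ
    -- Two terms of the sum contain x: j = i, dropped by `init`, and j = k, sitting at `κ`. In both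
    -- the other factor is a diagonal entry, equal to 1.
    s : Vector ℝ i
    s = init t
    κ : Fin i
    κ = fromℕ< k<i
    inject₁<i : ∀ (j : Fin i) → toℕ (inject₁ j) < i
    inject₁<i j = ≡.subst (_< i) (≡.sym (Finₚ.toℕ-inject₁ j)) (Finₚ.toℕ<n j)
    toℕ-κ : toℕ (inject₁ κ) ≡ k
    toℕ-κ = ≡.trans (Finₚ.toℕ-inject₁ κ) (Finₚ.toℕ-fromℕ< k<i)
    ≢k : ∀ j → toℕ (inject₁ (punchIn κ j)) ≡.≢ k
    ≢k j eq = Finₚ.punchInᵢ≢i κ j
      (Finₚ.inject₁-injective (Finₚ.toℕ-injective (≡.trans eq (≡.sym toℕ-κ))))
    sκ≈x : s κ ≈ᵣ x
    sκ≈x = begin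
      u (toℕ (inject₁ κ))       ≡⟨ ≡.cong u toℕ-κ ⟩
      (g ^ₛ k) k *ᵣ (g ^ₛ k) i  ≈⟨ R.*-congʳ (^-diagonal g g₀≈0 g₁≈1 k) ⟩
      R.1# *ᵣ x                 ≈⟨ R.*-identityˡ x ⟩
      x                         ∎
    last≈x : last t ≈ᵣ x
    last≈x = begin
      u (toℕ (fromℕ i))         ≡⟨ ≡.cong u (Finₚ.toℕ-fromℕ i) ⟩
      (g ^ₛ k) i *ᵣ (g ^ₛ i) i  ≈⟨ R.*-congˡ (^-diagonal g g₀≈0 g₁≈1 i) ⟩
      x *ᵣ R.1#                 ≈⟨ R.*-identityʳ x ⟩
      x                         ∎
    decompose : ((g ∘ₛ g) ^ₛ k) i ≈ᵣ x +ᵣ x +ᵣ R.sum (removeAt s κ)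
    decompose = begin
      -- Coefficient i of `(g ^ₛ k) ∘ₛ g` is `R.sum t` by definition.
      ((g ∘ₛ g) ^ₛ k) i                      ≈⟨ ∘-homo-^ g g₀≈0 g k i ⟨
      R.sum t                                ≈⟨ R.sum-init-last t ⟩
      R.sum s +ᵣ last t                      ≈⟨ R.+-cong (R.sum-remove {i = κ} s) last≈x ⟩
      s κ +ᵣ R.sum (removeAt s κ) +ᵣ x       ≈⟨ R.+-congʳ (R.+-congʳ sκ≈x) ⟩
      x +ᵣ R.sum (removeAt s κ) +ᵣ x         ≈⟨ R.+-assoc x _ x ⟩
      x +ᵣ (R.sum (removeAt s κ) +ᵣ x)       ≈⟨ R.+-congˡ {x} (R.+-comm _ x) ⟩
      x +ᵣ (x +ᵣ R.sum (removeAt s κ))       ≈⟨ R.+-assoc x x _ ⟨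
      x +ᵣ x +ᵣ R.sum (removeAt s κ)         ∎
    off-diagonal : ∀ j → j < i → j ≡.≢ k → Multiple (ℤ.+ 4) (u j)
    off-diagonal j j<i j≢k with ℕₚ.<-cmp j k
    -- The first factor lies above the diagonal.
    ... | tri< j<k _ _ = multiple-0
      (R.trans (R.*-congʳ (^-vanish g g₀≈0 j<k)) (R.zeroˡ _))
    ... | tri≈ _ j≡k _ = contradiction j≡k j≢k
    -- As k < j < i, both j - k and i - j are smaller than i - k, hence at most `N`; the moduli give
    -- 2 · 2 = 4.
    ... | tri> _ _ k<j = multiple-*
      (^-even p N k j k<j
        (ℕₚ.≤-pred (ℕₚ.≤-trans (ℕₚ.∸-monoˡ-< j<i (ℕₚ.<⇒≤ k<j)) i∸k≤N)))
      (^-even p N j i j<i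
        (ℕₚ.≤-pred (ℕₚ.≤-trans (ℕₚ.∸-monoʳ-< k<j (ℕₚ.<⇒≤ j<i)) i∸k≤N)))

-- The series F(4x)/4 and the integrality of A.

[4x]/4-multiple : ∀ f n → Multiple (ℤ.+ 4) (fromℤ ((f [4x]/4) (2 ℕ.+ n)))
-- The coefficient of xⁿ⁺² carries 4ⁿ⁺¹; splitting off one 4 leaves 4ⁿ in the quotient.
[4x]/4-multiple f n = multiple (ℤ.+ (4 ℕ.^ n) ℤ.* f (2 ℕ.+ n)) (fromℤ-cong (≡.trans
  (≡.cong (ℤ._* f (2 ℕ.+ n)) (ℤₚ.pos-* 4 (4 ℕ.^ n)))
  (ℤₚ.*-assoc (ℤ.+ 4) (ℤ.+ (4 ℕ.^ n)) (f (2 ℕ.+ n)))))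

corollary7 :
    (f : ℕ → ℤ) → f 0 ≡ 0ℤ → f 1 ≡ 1ℤ →
    (a : Series) → a 0 ≈ᵣ fromℤ 0ℤ → a 1 ≈ᵣ fromℤ 1ℤ →
    a ∘ₛ a ≋ (λ n → fromℤ ((f [4x]/4) n)) →
    ∀ n → 1 ≤ n → ∃ λ (z : ℤ) → a n ≈ᵣ fromℤ z
-- The linear coefficient lies on the diagonal, outside the reach of `^-even`.
corollary7 f f₀≡0 f₁≡1 a a₀≈0 a₁≈1 a∘a≋G 1             _ = 1ℤ , a₁≈1
corollary7 f f₀≡0 f₁≡1 a a₀≈0 a₁≈1 a∘a≋G n@(suc (suc _)) _ =
  -- Column k = 1, with n itself as a bound for the distance n - 1. The first power is `a ⊛ 1ₛ`,
  -- which `⊛-identityʳ` turns back into `a`.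
  let multiple z a^1≈2z = ^-even a a₀≈0 a₁≈1 powers n 1 n (s≤s (s≤s z≤n)) (ℕₚ.m∸n≤m n 1)
  in ℤ.+ 2 ℤ.* z , R.trans (R.sym (⊛-identityʳ a n)) a^1≈2z
  where
  G : Series
  G n = fromℤ ((f [4x]/4) n)
  G₁≈1 : G 1 ≈ᵣ R.1#
  G₁≈1 = fromℤ-cong (≡.cong (1ℤ ℤ.*_) f₁≡1)
  powers : ∀ k i → k < i → Multiple (ℤ.+ 4) (((a ∘ₛ a) ^ₛ k) i)
  powers k i k<i = multiple-cong (R.sym (^-cong k a∘a≋G i))
    (^-multiple G R.refl G₁≈1 ([4x]/4-multiple f) k i k<i)
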